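{- Let $t\in\mathbb{Z}\setminus\{ -1,0,1\}$ and put $A(t)=(A_0(t),A_1(t),A_2(t),A_3(t),A_4(t))$ with $$A_0(t)=64t^2(1-t^8),\quad A_1(t)=t^2+1,\quad A_2(t)=-(t^2+1),\quad A_3(t)=t^2-1,\quad A_4(t)=-(t^2-1).$$ Then the diagonal quintic threefold $\mathcal{V}_{A(t)}:\ \sum_{i=0}^{4}A_i(t)X_i^5=0$ contains infinitely many non-trivial integer points.
   Context: For $A=(A_0,\dots,A_4)\in\mathbb{Z}^5$, $\mathcal{V}_A$ denotes the variety $\sum_{i=0}^4 A_iX_i^5=0$. An integer point $(X_0,\dots,X_4)\in\mathbb{Z}^5$ on $\mathcal{V}_A$ is called non-trivial if $\gcd(X_0,\dots,X_4)=1$ and no proper (nonempty) sub-sum of $\sum_{i=0}^4 A_iX_i^5$ vanishes. -}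

module Defs where

open import Data.Bool using (Bool; true; false; if_then_else_)
open import Data.Integer using (ℤ; +_; -_; _+_; _-_; _*_; _^_; 0ℤ; 1ℤ)
open import Data.Integer.GCD using (gcd)
open import Data.Fin using (Fin)
open import Data.Fin.Subset using (Subset; ⊤; _⊂_; Nonempty)
open import Data.Vec using (Vec; []; _∷_; zipWith; foldr′)
open import Data.Product using (_×_)
open import Relation.Nullary using (¬_)
open import Relation.Binary.PropositionalEquality using (_≡_)

sumℤ : ∀ {n} → Vec ℤ n → ℤ
sumℤ = foldr′ _+_ 0ℤ

subSum : ∀ {n} → Vec ℤ n → Vec ℤ n → Subset n → ℤ
subSum A X S = sumℤ (zipWith (λ b t → if b then t else 0ℤ) S (zipWith (λ a x → a * x ^ 5) A X))

form : ∀ {n} → Vec ℤ n → Vec ℤ n → ℤ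
form A X = sumℤ (zipWith (λ a x → a * x ^ 5) A X)

gcdVec : ∀ {n} → Vec ℤ n → ℤ
gcdVec = foldr′ gcd 0ℤ

OnV : Vec ℤ 5 → Vec ℤ 5 → Set
OnV A X = form A X ≡ 0ℤ

NonTrivial : Vec ℤ 5 → Vec ℤ 5 → Set
NonTrivial A X = gcdVec X ≡ 1ℤ
  × (∀ (S : Subset 5) → Nonempty S → S ⊂ ⊤ → ¬ (subSum A X S ≡ 0ℤ))

A[_] : ℤ → Vec ℤ 5
A[ t ] = (+ 64 * t ^ 2 * (1ℤ - t ^ 8))
       ∷ (t ^ 2 + 1ℤ)
       ∷ (- (t ^ 2 + 1ℤ))
       ∷ (t ^ 2 - 1ℤ)
       ∷ (- (t ^ 2 - 1ℤ))
       ∷ []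

{-# OPTIONS --safe #-}
-- Put U = t², q = (U − 1)w and s = −(U + 1)w.  Whenever p² − r² = s² − q² = 4Uw², the point
-- (w, p + q, p − q, r + s, r − s) lies on the threefold, because
-- (p + q)⁵ − (p − q)⁵ = 2q(5(p² + q²)² − 4q⁴).  The choice p = Uw² + 1, r = Uw² − 1 leaves w free
-- and makes the second coordinate congruent to 1 modulo w, hence the point primitive.
-- A sub-sum of the five terms has the shape (y + Ux) + w(5(U² − 1)z + wρ), where x, y, z are small
-- integers depending only on the chosen index set.  For large w, a vanishing sub-sum forces
-- x = y = z = 0, so that the index set contains all or none of 1, 2, 3, 4; if it is also proper and
-- nonempty, the term with index 0 would have to vanish.
module Submission where

open import Defs
open import Data.Bool using (true; false; if_then_else_)
import Data.Bool.Properties as Bool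
open import Data.Fin.Subset using (Subset; inside; outside; ⊤; Nonempty; _⊂_)
open import Data.Fin.Subset.Properties using (anySubset?; ∈⊤; ∉⊥)
open import Data.Integer using (ℤ; +_; -[1+_]; -_; _+_; _-_; _*_; _^_; ∣_∣; 0ℤ; 1ℤ; ≢-nonZero)
open import Data.Integer.Divisibility.Signed using (∣ᵤ⇒∣; ∣⇒∣ᵤ; ∣-trans; ∣m+n∣n⇒∣m; ∣m⇒∣m*n) renaming (divides to dividesℤ; _∣_ to _∣ℤ_)
open import Data.Integer.GCD using (gcd; gcd[i,j]∣i; gcd[i,j]∣j)
open import Data.Integer.Properties using (_≟_; ∣i+j∣≤∣i∣+∣j∣; abs-*; i*j≡0⇒i≡0∨j≡0; i^n≡0⇒i≡0; i-j≡0⇒i≡j; +-identityˡ; +-identityʳ; *-zeroʳ; *-identityʳ; ^-*-assoc)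
open import Data.Integer.Solver using (module +-*-Solver)
open import Data.Integer.Tactic.RingSolver using (solve-∀)
open import Data.List using (List; map)
open import Data.List.Extrema.Nat using (max; xs≤max)
open import Data.List.Membership.Propositional using (_∉_)
open import Data.List.Membership.Propositional.Properties using (∈-map⁺)
import Data.List.Relation.Unary.All as All
import Data.Nat as ℕ
import Data.Nat.Divisibility as ℕ
import Data.Nat.Properties as ℕ
open import Data.Nat using (ℕ; suc; s≤s; z≤n)
open import Data.Product using (Σ; _×_; _,_; proj₁; proj₂)
open import Data.Sum using (_⊎_; inj₁; inj₂; [_,_]′)
open import Data.Vec using (Vec; []; _∷_; zipWith; head; tail; replicate) renaming (map to mapᵥ)
open import Data.Vec.Properties using (≡-dec)
open import Function using (_∘_)
open import Relation.Nullary using (¬_; Dec; yes; no; contradiction; ¬?; _×-dec_; _→-dec_; _⊎-dec_)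
open import Relation.Nullary.Decidable using (decidable-stable; from-no)
open import Relation.Binary.PropositionalEquality using (_≡_; _≢_; refl; sym; trans; cong; cong₂; subst; module ≡-Reasoning)

-- Sums over an index set.

selectSum : ∀ {n} → Subset n → Vec ℤ n → ℤ
selectSum S v = sumℤ (zipWith (λ b i → if b then i else 0ℤ) S v)

_⟨+_*⟩_ : ∀ {n} → Vec ℤ n → ℤ → Vec ℤ n → Vec ℤ n
u ⟨+ m *⟩ v = zipWith (λ i j → i + m * j) u v

-- `subSum A X S` unfolds to `selectSum S (terms A X)`, so linearity carries an expansion of the
-- terms in `w` over to every sub-sum.
selectSum-⟨+*⟩ : ∀ {n} (S : Subset n) m u v →
  selectSum S (u ⟨+ m *⟩ v) ≡ selectSum S u + m * selectSum S v
selectSum-⟨+*⟩ [] m [] [] = base m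
  where
  base : ∀ m → 0ℤ ≡ 0ℤ + m * 0ℤ
  base = solve-∀
selectSum-⟨+*⟩ (false ∷ S) m (i ∷ u) (j ∷ v) =
  trans (cong (_+_ 0ℤ) (selectSum-⟨+*⟩ S m u v)) (step m (selectSum S u) (selectSum S v))
  where
  step : ∀ m p q → 0ℤ + (p + m * q) ≡ (0ℤ + p) + m * (0ℤ + q)
  step = solve-∀
selectSum-⟨+*⟩ (true ∷ S) m (i ∷ u) (j ∷ v) =
  trans (cong (_+_ (i + m * j)) (selectSum-⟨+*⟩ S m u v)) (step m i j (selectSum S u) (selectSum S v))
  where
  step : ∀ m i j p q → (i + m * j) + (p + m * q) ≡ (i + p) + m * (j + q)
  step = solve-∀

selectSum-map-* : ∀ {n} (S : Subset n) k v → selectSum S (mapᵥ (k *_) v) ≡ k * selectSum S v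
selectSum-map-* [] k [] = sym (*-zeroʳ k)
selectSum-map-* (false ∷ S) k (i ∷ v) =
  trans (cong (_+_ 0ℤ) (selectSum-map-* S k v)) (step k (selectSum S v))
  where
  step : ∀ k p → 0ℤ + k * p ≡ k * (0ℤ + p)
  step = solve-∀
selectSum-map-* (true ∷ S) k (i ∷ v) =
  trans (cong (_+_ (k * i)) (selectSum-map-* S k v)) (step k i (selectSum S v))
  where
  step : ∀ k i p → k * i + k * p ≡ k * (i + p)
  step = solve-∀

selectSum-none : ∀ {n} (v : Vec ℤ n) → selectSum (replicate n outside) v ≡ 0ℤ
selectSum-none [] = refl
selectSum-none (_ ∷ v) = trans (+-identityˡ _) (selectSum-none v)

selectSum-all : ∀ {n} (v : Vec ℤ n) → selectSum (replicate n inside) v ≡ sumℤ v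
selectSum-all [] = refl
selectSum-all (i ∷ v) = cong (_+_ i) (selectSum-all v)

-- Four index sets remain. Properness and nonemptiness exclude the full and the empty one. The head
-- alone gives the claim directly; for its complement, the vanishing total does.
all-or-none⇒head≡0 : ∀ {n} i (v : Vec ℤ n) → sumℤ (i ∷ v) ≡ 0ℤ →
  ∀ S → Nonempty S → S ⊂ ⊤ → tail S ≡ replicate n inside ⊎ tail S ≡ replicate n outside →
  selectSum S (i ∷ v) ≡ 0ℤ → i ≡ 0ℤ
all-or-none⇒head≡0 i v total (true ∷ _) _ (_ , _ , _ , j∉⊤) (inj₁ refl) eq =
  contradiction ∈⊤ j∉⊤
all-or-none⇒head≡0 i v total (false ∷ _) _ _ (inj₁ refl) eq =
  trans (sym (+-identityʳ i)) (trans (cong (_+_ i) (sym rest≡0)) total)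
  where
  rest≡0 : sumℤ v ≡ 0ℤ
  rest≡0 = trans (sym (selectSum-all v)) (trans (sym (+-identityˡ _)) eq)
all-or-none⇒head≡0 i v total (true ∷ _) _ _ (inj₂ refl) eq =
  trans (sym (trans (cong (_+_ i) (selectSum-none v)) (+-identityʳ i))) eq
all-or-none⇒head≡0 i v total (false ∷ _) (_ , j∈⊥) _ (inj₂ refl) eq =
  contradiction j∈⊥ ∉⊥

-- Digits and non-vanishing in `ℤ`.

digit≡0 : ∀ d m e → ∣ d ∣ ℕ.< ∣ m ∣ → d + m * e ≡ 0ℤ → d ≡ 0ℤ × e ≡ 0ℤ
digit≡0 d m e ∣d∣<∣m∣ eq = d≡0 , e≡0
  where
  -- Thus `m` divides `d`, which is too small to be a nonzero multiple.
  d≡-e*m : d ≡ (- e) * m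
  d≡-e*m = trans (rearrange d m e) (trans (cong (_+ (- e) * m) eq) (+-identityˡ _))
    where
    rearrange : ∀ d m e → d ≡ (d + m * e) + (- e) * m
    rearrange = solve-∀

  d≡0 : d ≡ 0ℤ
  d≡0 with d ≟ 0ℤ
  ... | yes p = p
  ... | no d≢0 = contradiction (∣⇒∣ᵤ {m} {d} (dividesℤ (- e) d≡-e*m))
                               (ℕ.>⇒∤ {{≢-nonZero d≢0}} ∣d∣<∣m∣)

  m≢0 : m ≢ 0ℤ
  m≢0 refl = contradiction ∣d∣<∣m∣ ℕ.n≮0

  e≡0 : e ≡ 0ℤ
  e≡0 = [ (λ m≡0 → contradiction m≡0 m≢0) , (λ p → p) ]′
    (i*j≡0⇒i≡0∨j≡0 m (trans (sym (+-identityˡ _)) (subst (λ d → d + m * e ≡ 0ℤ) d≡0 eq)))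

∣i^n∣≡∣i∣^n : ∀ i n → ∣ i ^ n ∣ ≡ ∣ i ∣ ℕ.^ n
∣i^n∣≡∣i∣^n i ℕ.zero = refl
∣i^n∣≡∣i∣^n i (suc n) = trans (abs-* i (i ^ n)) (cong (∣ i ∣ ℕ.*_) (∣i^n∣≡∣i∣^n i n))

i^[1+n]≢1 : ∀ i n → 1 ℕ.< ∣ i ∣ → i ^ suc n ≢ 1ℤ
i^[1+n]≢1 i n 1<∣i∣ eq
  with ℕ.m^n≡1⇒n≡0∨m≡1 ∣ i ∣ (suc n) (trans (sym (∣i^n∣≡∣i∣^n i (suc n))) (cong ∣_∣ eq))
... | inj₂ ∣i∣≡1 = ℕ.<⇒≢ 1<∣i∣ (sym ∣i∣≡1)

*-≢0 : ∀ i j → i ≢ 0ℤ → j ≢ 0ℤ → i * j ≢ 0ℤ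
*-≢0 i j i≢0 j≢0 eq = [ i≢0 , j≢0 ]′ (i*j≡0⇒i≡0∨j≡0 i eq)

1<∣i∣⇒i≢0 : ∀ i → 1 ℕ.< ∣ i ∣ → i ≢ 0ℤ
1<∣i∣⇒i≢0 _ () refl

-- Sign patterns of the terms.

xs ys zs : Vec ℤ 5
-- Modulo w², each term is (y + Ux) + 5(U² - 1)zw with x, y, z the entries at its index. The term
-- with index 0 is a multiple of w⁵, hence the leading zeros.
xs = 0ℤ ∷ 1ℤ ∷ - 1ℤ ∷ - 1ℤ ∷ 1ℤ ∷ []
ys = 0ℤ ∷ 1ℤ ∷ - 1ℤ ∷ 1ℤ ∷ - 1ℤ ∷ []
zs = 0ℤ ∷ 1ℤ ∷ 1ℤ ∷ - 1ℤ ∷ - 1ℤ ∷ []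

-- On the indices 1 to 4 the three patterns and the all-ones vector are pairwise orthogonal, so an
-- indicator vector orthogonal to all three patterns is constant. Each pattern has two entries 1 and
-- two entries -1, hence the bound 2.
Constrained : Subset 5 → Set
Constrained S =
  ∣ selectSum S xs ∣ ℕ.≤ 2 × ∣ selectSum S ys ∣ ℕ.≤ 2 × ∣ selectSum S zs ∣ ℕ.≤ 2 ×
  (selectSum S xs ≡ 0ℤ × selectSum S ys ≡ 0ℤ × selectSum S zs ≡ 0ℤ →
    tail S ≡ replicate 4 inside ⊎ tail S ≡ replicate 4 outside)

constrained : ∀ S → Constrained S
-- The search for a counterexample among the 32 subsets is settled by evaluation.
constrained S = decidable-stable (constrained? S)
  (λ ¬c → from-no (anySubset? (¬? ∘ constrained?)) (S , ¬c))
  where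
  constrained? : ∀ S → Dec (Constrained S)
  constrained? S =
    ∣ selectSum S xs ∣ ℕ.≤? 2 ×-dec ∣ selectSum S ys ∣ ℕ.≤? 2 ×-dec ∣ selectSum S zs ∣ ℕ.≤? 2 ×-dec
    ((selectSum S xs ≟ 0ℤ ×-dec selectSum S ys ≟ 0ℤ ×-dec selectSum S zs ≟ 0ℤ) →-dec
      (≡-dec Bool._≟_ (tail S) (replicate 4 inside) ⊎-dec
       ≡-dec Bool._≟_ (tail S) (replicate 4 outside)))

-- The family of points.

point : ℤ → ℤ → Vec ℤ 5
point U w = w
          ∷ (1ℤ + w * ((U - 1ℤ) + w * U))
          ∷ (1ℤ + w * (- (U - 1ℤ) + w * U))
          ∷ (- 1ℤ + w * (- (U + 1ℤ) + w * U))
          ∷ (- 1ℤ + w * ((U + 1ℤ) + w * U))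
          ∷ []

terms : Vec ℤ 5 → Vec ℤ 5 → Vec ℤ 5
terms = zipWith (λ a x → a * x ^ 5)

point-onV : ∀ t w → OnV A[ t ] (point (t ^ 2) w)
point-onV t w = trans
  -- Rewriting `t ^ 8` as `U ^ 4` leaves a polynomial identity in `U` and `w`.
  (cong (λ c → + 64 * U * (1ℤ - c) * w ^ 5 + sumℤ (tail (terms A[ t ] (point U w))))
        (sym (^-*-assoc t 2 4)))
  (identity U w)
  where
  U = t ^ 2
  identity : ∀ U w → (+ 64 * U * (1ℤ - U ^ 4)) * w ^ 5
    + ((U + 1ℤ) * (1ℤ + w * ((U - 1ℤ) + w * U)) ^ 5
    + (- (U + 1ℤ) * (1ℤ + w * (- (U - 1ℤ) + w * U)) ^ 5
    + ((U - 1ℤ) * (- 1ℤ + w * (- (U + 1ℤ) + w * U)) ^ 5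
    + (- (U - 1ℤ) * (- 1ℤ + w * ((U + 1ℤ) + w * U)) ^ 5 + 0ℤ)))) ≡ 0ℤ
  identity = solve 2 (λ U w → (con (+ 64) :* U :* (con 1ℤ :- U :^ 4)) :* w :^ 5
    :+ ((U :+ con 1ℤ) :* (con 1ℤ :+ w :* ((U :- con 1ℤ) :+ w :* U)) :^ 5
    :+ (:- (U :+ con 1ℤ) :* (con 1ℤ :+ w :* (:- (U :- con 1ℤ) :+ w :* U)) :^ 5
    :+ ((U :- con 1ℤ) :* (:- con 1ℤ :+ w :* (:- (U :+ con 1ℤ) :+ w :* U)) :^ 5
    :+ (:- (U :- con 1ℤ) :* (:- con 1ℤ :+ w :* ((U :+ con 1ℤ) :+ w :* U)) :^ 5 :+ con 0ℤ)))) := con 0ℤ) refl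
    where open +-*-Solver

point-primitive : ∀ U w → gcdVec (point U w) ≡ 1ℤ
point-primitive U w = cong (+_) (ℕ.∣1⇒≡1 (∣⇒∣ᵤ {g} {1ℤ} g∣1))
  where
  k = (U - 1ℤ) + w * U
  h = gcdVec (tail (tail (point U w)))
  g = gcdVec (point U w)
  g∣w : g ∣ℤ w
  g∣w = ∣ᵤ⇒∣ (gcd[i,j]∣i w (gcd (1ℤ + w * k) h))
  g∣1+wk : g ∣ℤ 1ℤ + w * k
  g∣1+wk = ∣-trans {j = gcd (1ℤ + w * k) h}
    (∣ᵤ⇒∣ (gcd[i,j]∣j w (gcd (1ℤ + w * k) h))) (∣ᵤ⇒∣ (gcd[i,j]∣i (1ℤ + w * k) h))
  g∣1 : g ∣ℤ 1ℤ
  g∣1 = ∣m+n∣n⇒∣m {g} {1ℤ} g∣1+wk (∣m⇒∣m*n k g∣w)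

-- Expansion in powers of `w`.

quinticTail : ℤ → ℤ → ℤ → ℤ
quinticTail w s u =
  + 10 * s ^ 3 * u ^ 2 + w * (+ 10 * s ^ 2 * u ^ 3 + w * (+ 5 * s * u ^ 4 + w * u ^ 5))

-- This is the binomial theorem, with `quinticTail` collecting the terms of degree at least 2 in
-- `w * u`, divided by `w ^ 2`. At first order only `d` contributes.
^5-expansion : ∀ w s d e → let u = d + w * e in
  (s + w * u) ^ 5 ≡ s ^ 5 + w * (+ 5 * s ^ 4 * d + w * (+ 5 * s ^ 4 * e + quinticTail w s u))
^5-expansion w s d e = trans (binomial w s (d + w * e))
  (regroup w (s ^ 5) (+ 5 * s ^ 4) d e (quinticTail w s (d + w * e)))
  where
  open +-*-Solver
  binomial : ∀ w s u → (s + w * u) ^ 5 ≡ s ^ 5 + w * (+ 5 * s ^ 4 * u + w * quinticTail w s u)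
  binomial = solve 3 (λ w s u → (s :+ w :* u) :^ 5 :=
    s :^ 5 :+ w :* (con (+ 5) :* s :^ 4 :* u :+ w :*
      (con (+ 10) :* s :^ 3 :* u :^ 2 :+ w :*
        (con (+ 10) :* s :^ 2 :* u :^ 3 :+ w :* (con (+ 5) :* s :* u :^ 4 :+ w :* u :^ 5))))) refl
  regroup : ∀ w a b d e r → a + w * (b * (d + w * e) + w * r) ≡ a + w * (b * d + w * (b * e + r))
  regroup = solve-∀

K[_] : ℤ → ℤ
K[ U ] = + 5 * (U * U - 1ℤ)

-- The remainder `ρs` is left existential because `digit≡0` bounds only the low digit.
terms-expansion : ∀ t w → let U = t ^ 2 in Σ (Vec ℤ 5) λ ρs →
  terms A[ t ] (point U w) ≡ (ys ⟨+ U *⟩ xs) ⟨+ w *⟩ (mapᵥ (_*_ K[ U ]) zs ⟨+ w *⟩ ρs)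
terms-expansion t w = _ ,
  cong₂ _∷_ (e₀ (head A[ t ]) U w) (
  cong₂ _∷_ (trans (cong (_*_ (U + 1ℤ)) (^5-expansion w 1ℤ (U - 1ℤ) U)) (e₁ U w _)) (
  cong₂ _∷_ (trans (cong (_*_ (- (U + 1ℤ))) (^5-expansion w 1ℤ (- (U - 1ℤ)) U)) (e₂ U w _)) (
  cong₂ _∷_ (trans (cong (_*_ (U - 1ℤ)) (^5-expansion w (- 1ℤ) (- (U + 1ℤ)) U)) (e₃ U w _)) (
  cong₂ _∷_ (trans (cong (_*_ (- (U - 1ℤ))) (^5-expansion w (- 1ℤ) (U + 1ℤ) U)) (e₄ U w _)) refl))))
  where
  U = t ^ 2
  e₀ : ∀ c U w → c * w ^ 5 ≡
    (0ℤ + U * 0ℤ) + w * (+ 5 * (U * U - 1ℤ) * 0ℤ + w * (c * w ^ 3))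
  e₀ = solve 3 (λ c U w → c :* w :^ 5 :=
    (con 0ℤ :+ U :* con 0ℤ) :+ w :* (con (+ 5) :* (U :* U :- con 1ℤ) :* con 0ℤ :+ w :* (c :* w :^ 3))) refl
    where open +-*-Solver
  -- For `s` equal to 1 or -1, `s ^ 5` and `+ 5 * s ^ 4` reduce by computation; the product of
  -- `U + 1ℤ` and `U - 1ℤ` then produces `K[ U ]` up to sign.
  e₁ : ∀ U w r → (U + 1ℤ) * (1ℤ + w * (+ 5 * (U - 1ℤ) + w * r)) ≡
    (1ℤ + U * 1ℤ) + w * (+ 5 * (U * U - 1ℤ) * 1ℤ + w * ((U + 1ℤ) * r))
  e₁ = solve-∀
  e₂ : ∀ U w r → - (U + 1ℤ) * (1ℤ + w * (+ 5 * - (U - 1ℤ) + w * r)) ≡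
    (- 1ℤ + U * - 1ℤ) + w * (+ 5 * (U * U - 1ℤ) * 1ℤ + w * (- (U + 1ℤ) * r))
  e₂ = solve-∀
  e₃ : ∀ U w r → (U - 1ℤ) * (- 1ℤ + w * (+ 5 * - (U + 1ℤ) + w * r)) ≡
    (1ℤ + U * - 1ℤ) + w * (+ 5 * (U * U - 1ℤ) * - 1ℤ + w * ((U - 1ℤ) * r))
  e₃ = solve-∀
  e₄ : ∀ U w r → - (U - 1ℤ) * (- 1ℤ + w * (+ 5 * (U + 1ℤ) + w * r)) ≡
    (- 1ℤ + U * 1ℤ) + w * (+ 5 * (U * U - 1ℤ) * - 1ℤ + w * (- (U - 1ℤ) * r))
  e₄ = solve-∀

subSum-expansion : ∀ t w S → let U = t ^ 2 in Σ ℤ λ ρ →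
  subSum A[ t ] (point U w) S ≡
  (selectSum S ys + U * selectSum S xs) + w * (K[ U ] * selectSum S zs + w * ρ)
subSum-expansion t w S = selectSum S ρs , (begin
  selectSum S (terms A[ t ] (point U w))
    ≡⟨ cong (selectSum S) (proj₂ (terms-expansion t w)) ⟩
  selectSum S ((ys ⟨+ U *⟩ xs) ⟨+ w *⟩ (mapᵥ (_*_ K[ U ]) zs ⟨+ w *⟩ ρs))
    ≡⟨ selectSum-⟨+*⟩ S w _ _ ⟩
  selectSum S (ys ⟨+ U *⟩ xs) + w * selectSum S (mapᵥ (_*_ K[ U ]) zs ⟨+ w *⟩ ρs)
    ≡⟨ cong₂ (λ i j → i + w * j) (selectSum-⟨+*⟩ S U ys xs)
         (trans (selectSum-⟨+*⟩ S w _ ρs)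
                (cong (λ i → i + w * selectSum S ρs) (selectSum-map-* S K[ U ] zs))) ⟩
  (selectSum S ys + U * selectSum S xs) + w * (K[ U ] * selectSum S zs + w * selectSum S ρs) ∎)
  where
  open ≡-Reasoning
  U = t ^ 2
  ρs = proj₁ (terms-expansion t w)

-- Non-vanishing of proper sub-sums.

bound : ℤ → ℕ
-- The summands estimate |y + Ux| and |5(U² - 1)z| for |x|, |y|, |z| at most 2; their sum dominates
-- both.
bound t = (2 ℕ.+ ∣ t ^ 2 ∣ ℕ.* 2) ℕ.+ ∣ K[ t ^ 2 ] ∣ ℕ.* 2

module _ (t : ℤ) (1<∣t∣ : 1 ℕ.< ∣ t ∣) (n : ℕ) (bound<n : bound t ℕ.< n) where

  private
    U w : ℤ
    U = t ^ 2
    w = + n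

    -- This makes every value of y, at most 2 in size, a digit in base `U`.
    2<∣U∣ : 2 ℕ.< ∣ U ∣
    2<∣U∣ = ℕ.<-≤-trans (s≤s (s≤s (s≤s z≤n)))
      (ℕ.≤-trans (ℕ.*-mono-≤ 1<∣t∣ 1<∣t∣)
        (ℕ.≤-reflexive (sym (trans (abs-* t (t * 1ℤ))
          (cong (λ m → ∣ t ∣ ℕ.* m) (trans (abs-* t 1ℤ) (ℕ.*-identityʳ _)))))))

    1<∣U∣ : 1 ℕ.< ∣ U ∣
    1<∣U∣ = ℕ.<-trans (ℕ.n<1+n 1) 2<∣U∣

    K≢0 : K[ U ] ≢ 0ℤ
    K≢0 = *-≢0 (+ 5) (U * U - 1ℤ) (λ ()) λ eq →
      i^[1+n]≢1 U 1 1<∣U∣ (trans (cong (_*_ U) (*-identityʳ U)) (i-j≡0⇒i≡j (U * U) 1ℤ eq))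

    firstTerm≢0 : head A[ t ] * (+ n) ^ 5 ≢ 0ℤ
    firstTerm≢0 = *-≢0 (head A[ t ]) (w ^ 5)
      (*-≢0 (+ 64 * U) (1ℤ - t ^ 8) (*-≢0 (+ 64) U (λ ()) (1<∣i∣⇒i≢0 U 1<∣U∣))
            (i^[1+n]≢1 t 7 1<∣t∣ ∘ sym ∘ i-j≡0⇒i≡j 1ℤ (t ^ 8)))
      (w≢0 ∘ i^n≡0⇒i≡0 w 5)
      where
      w≢0 : w ≢ 0ℤ
      w≢0 eq = contradiction (subst (λ i → bound t ℕ.< ∣ i ∣) eq bound<n) ℕ.n≮0

  -- Digits are read three times: base `w` isolates `y + U * x`, base `w` again isolates
  -- `K[ U ] * z`, and base `U` separates `y` from `x`.
  subSum≡0⇒all-or-none : ∀ S → subSum A[ t ] (point (t ^ 2) (+ n)) S ≡ 0ℤ →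
    tail S ≡ replicate 4 inside ⊎ tail S ≡ replicate 4 outside
  subSum≡0⇒all-or-none S eq = balanced⇒all-or-none
    (proj₂ y≡0×x≡0 , proj₁ y≡0×x≡0 , z≡0)
    where
    x = selectSum S xs
    y = selectSum S ys
    z = selectSum S zs
    ρ = proj₁ (subSum-expansion t w S)

    ∣x∣≤2 = proj₁ (constrained S)
    ∣y∣≤2 = proj₁ (proj₂ (constrained S))
    ∣z∣≤2 = proj₁ (proj₂ (proj₂ (constrained S)))
    balanced⇒all-or-none = proj₂ (proj₂ (proj₂ (constrained S)))

    ∣y+Ux∣<n : ∣ y + U * x ∣ ℕ.< n
    ∣y+Ux∣<n = ℕ.≤-<-trans
      (ℕ.≤-trans (∣i+j∣≤∣i∣+∣j∣ y (U * x))
        (ℕ.≤-trans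
          (ℕ.+-mono-≤ ∣y∣≤2
            (ℕ.≤-trans (ℕ.≤-reflexive (abs-* U x)) (ℕ.*-monoʳ-≤ ∣ U ∣ ∣x∣≤2)))
          (ℕ.m≤m+n (2 ℕ.+ ∣ U ∣ ℕ.* 2) (∣ K[ U ] ∣ ℕ.* 2))))
      bound<n

    ∣Kz∣<n : ∣ K[ U ] * z ∣ ℕ.< n
    ∣Kz∣<n = ℕ.≤-<-trans
      (ℕ.≤-trans (ℕ.≤-reflexive (abs-* K[ U ] z))
        (ℕ.≤-trans (ℕ.*-monoʳ-≤ ∣ K[ U ] ∣ ∣z∣≤2)
          (ℕ.m≤n+m (∣ K[ U ] ∣ ℕ.* 2) (2 ℕ.+ ∣ U ∣ ℕ.* 2))))
      bound<n

    digits≡0 : y + U * x ≡ 0ℤ × K[ U ] * z + w * ρ ≡ 0ℤ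
    digits≡0 = digit≡0 (y + U * x) w (K[ U ] * z + w * ρ) ∣y+Ux∣<n
      (trans (sym (proj₂ (subSum-expansion t w S))) eq)

    y≡0×x≡0 : y ≡ 0ℤ × x ≡ 0ℤ
    y≡0×x≡0 = digit≡0 y U x (ℕ.≤-<-trans ∣y∣≤2 2<∣U∣) (proj₁ digits≡0)

    z≡0 : z ≡ 0ℤ
    z≡0 = [ (λ K≡0 → contradiction K≡0 K≢0) , (λ p → p) ]′
      (i*j≡0⇒i≡0∨j≡0 K[ U ] (proj₁ (digit≡0 (K[ U ] * z) w ρ ∣Kz∣<n (proj₂ digits≡0))))

  subSum≢0 : ∀ S → Nonempty S → S ⊂ ⊤ → ¬ (subSum A[ t ] (point (t ^ 2) (+ n)) S ≡ 0ℤ)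
  subSum≢0 S S≢∅ S⊂⊤ eq = firstTerm≢0
    (all-or-none⇒head≡0 (head A[ t ] * (+ n) ^ 5) (tail (terms A[ t ] (point (t ^ 2) (+ n))))
      (point-onV t w) S S≢∅ S⊂⊤ (subSum≡0⇒all-or-none S eq) eq)

  point-nonTrivial : NonTrivial A[ t ] (point (t ^ 2) (+ n))
  point-nonTrivial = point-primitive (t ^ 2) (+ n) , subSum≢0

-- Infinitude, as escape from every finite list.

1<∣t∣ : ∀ t → t ≢ - 1ℤ → t ≢ 0ℤ → t ≢ 1ℤ → 1 ℕ.< ∣ t ∣
1<∣t∣ (+ 0) _ t≢0 _ = contradiction refl t≢0
1<∣t∣ (+ 1) _ _ t≢1 = contradiction refl t≢1
1<∣t∣ (+ suc (suc _)) _ _ _ = s≤s (s≤s z≤n)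
1<∣t∣ -[1+ 0 ] t≢-1 _ _ = contradiction refl t≢-1
1<∣t∣ -[1+ suc _ ] _ _ _ = s≤s (s≤s z≤n)

-- The first coordinate of `point U w` is the free parameter `w`, so it can be made to exceed all
-- first coordinates in `L`.
large-head∉ : ∀ (L : List (Vec ℤ 5)) X → max 0 (map (∣_∣ ∘ head) L) ℕ.< ∣ head X ∣ → X ∉ L
large-head∉ L X max<∣head∣ X∈L = ℕ.<⇒≱ max<∣head∣
  (All.lookup (xs≤max 0 (map (∣_∣ ∘ head) L)) (∈-map⁺ (∣_∣ ∘ head) X∈L))

new-point : ∀ t L → 1 ℕ.< ∣ t ∣ →
  ∀ n → bound t ℕ.< n → max 0 (map (∣_∣ ∘ head) L) ℕ.< n →
  Σ (Vec ℤ 5) λ X → OnV A[ t ] X × NonTrivial A[ t ] X × X ∉ L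
new-point t L 1<∣t∣ n bound<n max<n =
  point (t ^ 2) (+ n) ,
  point-onV t (+ n) ,
  point-nonTrivial t 1<∣t∣ n bound<n ,
  large-head∉ L (point (t ^ 2) (+ n)) max<n

theorem3p1 : (t : ℤ) → ¬ (t ≡ - 1ℤ) → ¬ (t ≡ 0ℤ) → ¬ (t ≡ 1ℤ)
    → (L : List (Vec ℤ 5))
    → Σ (Vec ℤ 5) (λ X → OnV A[ t ] X × NonTrivial A[ t ] X × X ∉ L)
theorem3p1 t t≢-1 t≢0 t≢1 L =
  -- One more than the sum of two lower bounds exceeds each of them.
  new-point t L (1<∣t∣ t t≢-1 t≢0 t≢1) (suc (bound t ℕ.+ m))
    (s≤s (ℕ.m≤m+n (bound t) m)) (s≤s (ℕ.m≤n+m m (bound t)))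
  where m = max 0 (map (∣_∣ ∘ head) L)
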